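{- Let $n\ge 3$, $k\ge 3$. For each $\alpha=a_1\cdots a_n\in\mathbf{A}_k(n)\setminus\{r_{n,k}\}$ let $p(\alpha)$ be the position modified by the parent rule, namely $p(\alpha)=j$ if $\mathrm{Par}(\alpha)=\mathrm{LastNonMax}(\alpha)$, $p(\alpha)=n$ if $\mathrm{Par}(\alpha)$ is obtained via $\mathrm{LastSymbol}$, $p(\alpha)=i$ if obtained via $\mathrm{FirstNonMin}$, and $p(\alpha)=\ell$ if obtained via $\mathrm{SecondLastNonMax}$ (with $i,j,\ell$ as defined below, and the case determined by the first operation in the list that yields an element of $\mathbf{A}_k(n)$). Let $s(\alpha)=a_{p+1}\cdots a_na_1\cdots a_{p-1}$ (length $n-1$) where $p=p(\alpha)$; thus $\alpha$ and $\mathrm{Par}(\alpha)$ are joined via the conjugate pair $(a_p s(\alpha),\, y\, s(\alpha))$ with $y\ne a_p$ and $y s(\alpha)\in[\mathrm{Par}(\alpha)]$. Then the tree induced by $\mathrm{Par}$ has the Chain Property: if $\alpha\neq\alpha'$ are elements of $\mathbf{A}_k(n)\setminus\{r_{n,k}\}$ with $\mathrm{Par}(\alpha)=\mathrm{Par}(\alpha')$, then $s(\alpha)\neq s(\alpha')$.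
   Context: Let $\Sigma=\{0,1,\dots,k-1\}$. Strings are compared lexicographically ($\alpha<\beta$ if $\alpha$ is a proper prefix of $\beta$, or $\alpha$ has the smaller symbol at the first index where they differ). For $\alpha=a_1\cdots a_n$, $\alpha^R=a_n\cdots a_1$; $[\alpha]$ is the set of rotations of $\alpha$. $\alpha$ is a necklace if it is the lexicographically smallest element of $[\alpha]$; a bracelet if it is the lexicographically smallest element of $[\alpha]\cup[\alpha^R]$. A necklace $\alpha$ is symmetric if $\alpha^R\in[\alpha]$, asymmetric otherwise. $\mathbf{A}_k(n)$ is the set of asymmetric bracelets of length $n$ over $\Sigma$. $r_{n,k}=0^{n-2}(k-2)(k-1)$. Operations on $\alpha=a_1\cdots a_n$: $\mathrm{LastNonMax}(\alpha)=a_1\cdots a_{j-1}(a_j+1)(k-1)^{n-j}$, where $j$ is the index of the last symbol different from $k-1$; $\mathrm{LastSymbol}(\alpha)$ is the necklace (smallest rotation) of $a_1\cdots a_{n-1}((a_n+1)\bmod k)$; $\mathrm{FirstNonMin}(\alpha)=0^{i-1}(a_i-1)a_{i+1}\cdots a_n$, where $i$ is the index of the first nonzero symbol; $\mathrm{SecondLastNonMax}(\alpha)=a_1\cdots a_{\ell-1}(a_\ell+1)a_{\ell+1}\cdots a_n$, where $\ell$ is the index of the second-last symbol different from $k-1$. Parent rule: for $\alpha\in\mathbf{A}_k(n)\setminus\{r_{n,k}\}$, $\mathrm{Par}(\alpha)$ is the first string in the list $\langle \mathrm{LastNonMax}(\alpha),\mathrm{LastSymbol}(\alpha),\mathrm{FirstNonMin}(\alpha),\mathrm{SecondLastNonMax}(\alpha)\rangle$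 that belongs to $\mathbf{A}_k(n)$ (this is always well defined). -}

module Defs where

open import Data.Fin.Base as Fin using (Fin; toℕ)
open import Data.Fin.Properties using (nonZeroIndex)
open import Data.List.Base as List using (List; []; _∷_; _++_; drop; take)
open import Data.Nat.Base using (ℕ; suc; _∸_)
open import Data.Nat.DivMod using (_mod_)
open import Data.Product.Base using (_×_; ∃-syntax; ∃₂)
open import Data.Sum.Base using (_⊎_)
open import Data.Vec.Base as Vec using (Vec; lookup; _[_]≔_; toList)
open import Data.Vec.Relation.Binary.Lex.Strict using (Lex-≤)
open import Relation.Binary.PropositionalEquality using (_≡_; _≢_)
open import Relation.Nullary using (¬_)

private
  variable
    k n : ℕ

-- Strings of length n over {0,…,k-1}.  Positions are 0-based: p : Fin n
-- stands for the 1-based index suc (toℕ p).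
Str : ℕ → ℕ → Set
Str k n = Vec (Fin k) n

_≼_ : Str k n → Str k n → Set
_≼_ = Lex-≤ _≡_ Fin._<_

-- ys ∈ [xs], as ys = vu for some factorisation xs = uv.
Rotation : List (Fin k) → List (Fin k) → Set
Rotation xs ys = ∃₂ λ u v → xs ≡ u ++ v × ys ≡ v ++ u

_∈[_] : Str k n → Str k n → Set
β ∈[ α ] = Rotation (toList α) (toList β)

IsSmallest : (Str k n → Set) → Str k n → Set
IsSmallest S α = S α × (∀ β → S β → α ≼ β)

IsNecklace : Str k n → Set
IsNecklace α = IsSmallest (_∈[ α ]) α

IsBracelet : Str k n → Set
IsBracelet α = IsSmallest (λ β → β ∈[ α ] ⊎ β ∈[ Vec.reverse α ]) α

IsSymmetric : Str k n → Set
IsSymmetric α = Vec.reverse α ∈[ α ]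

AsymBracelet : Str k n → Set
AsymBracelet α = IsBracelet α × ¬ IsSymmetric α

-- α = r_{n,k} = 0^{n-2}(k-2)(k-1); intended for n ≥ 2 and k ≥ 2.
IsRoot : Str k n → Set
IsRoot {k} {n} α =
  List.map toℕ (toList α) ≡ List.replicate (n ∸ 2) 0 ++ (k ∸ 2) ∷ (k ∸ 1) ∷ []

NonRoot : Str k n → Set
NonRoot α = AsymBracelet α × ¬ IsRoot α

IsMin IsMax : Fin k → Set
IsMin a = toℕ a ≡ 0
IsMax {k} a = toℕ a ≡ k ∸ 1

IsLastNonMax : Str k n → Fin n → Set
IsLastNonMax α j =
  ¬ IsMax (lookup α j) × (∀ m → j Fin.< m → IsMax (lookup α m))

IsFirstNonMin : Str k n → Fin n → Set
IsFirstNonMin α i =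
  ¬ IsMin (lookup α i) × (∀ m → m Fin.< i → IsMin (lookup α m))

IsSecondLastNonMax : Str k n → Fin n → Set
IsSecondLastNonMax α ℓ =
  ¬ IsMax (lookup α ℓ) ×
  (∃[ j ] ℓ Fin.< j × IsLastNonMax α j ×
          (∀ m → ℓ Fin.< m → m Fin.< j → IsMax (lookup α m)))

sucMod : Fin k → Fin k
sucMod {k} a = _mod_ (suc (toℕ a)) k {{nonZeroIndex a}}

-- The operations are partial, so each is given by its graph: Op α p β says
-- that the operation sends α to β by modifying position p.
LastNonMax LastSymbol FirstNonMin SecondLastNonMax :
  Str k n → Fin n → Str k n → Set

LastNonMax α j β =
  IsLastNonMax α j ×
  (∃[ y ] toℕ y ≡ suc (toℕ (lookup α j)) × β ≡ α [ j ]≔ y)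

LastSymbol {n = n} α p β =
  suc (toℕ p) ≡ n × IsNecklace β × β ∈[ α [ p ]≔ sucMod (lookup α p) ]

FirstNonMin α i β =
  IsFirstNonMin α i ×
  (∃[ y ] suc (toℕ y) ≡ toℕ (lookup α i) × β ≡ α [ i ]≔ y)

SecondLastNonMax α ℓ β =
  IsSecondLastNonMax α ℓ ×
  (∃[ y ] toℕ y ≡ suc (toℕ (lookup α ℓ)) × β ≡ α [ ℓ ]≔ y)

YieldsAsymBracelet : (Str k n → Fin n → Str k n → Set) → Str k n → Set
YieldsAsymBracelet Op α = ∃₂ λ p β → Op α p β × AsymBracelet β

-- Par α p β : Par(α) = β and p(α) = p.
data Par {k n : ℕ} (α : Str k n) (p : Fin n) (β : Str k n) : Set where
  viaLastNonMax :
    LastNonMax α p β → AsymBracelet β → Par α p β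
  viaLastSymbol :
    ¬ YieldsAsymBracelet LastNonMax α →
    LastSymbol α p β → AsymBracelet β → Par α p β
  viaFirstNonMin :
    ¬ YieldsAsymBracelet LastNonMax α →
    ¬ YieldsAsymBracelet LastSymbol α →
    FirstNonMin α p β → AsymBracelet β → Par α p β
  viaSecondLastNonMax :
    ¬ YieldsAsymBracelet LastNonMax α →
    ¬ YieldsAsymBracelet LastSymbol α →
    ¬ YieldsAsymBracelet FirstNonMin α →
    SecondLastNonMax α p β → AsymBracelet β → Par α p β

-- a_{p+1}⋯a_n a_1⋯a_{p-1}
s : Str k n → Fin n → List (Fin k)
s α p = drop (suc (toℕ p)) (toList α) ++ take (toℕ p) (toList α)

-- α and β are joined via the conjugate pair (a_p s, y s) for some y ≠ a_p.
Joined : Str k n → Fin n → Str k n → Set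
Joined α p β =
  Rotation (toList α) (lookup α p ∷ s α p) ×
  (∃[ y ] y ≢ lookup α p × Rotation (toList β) (y ∷ s α p))

{-# OPTIONS --safe #-}
module Submission where

-- Write M = k − 1.  Comparing symbol sums, s(α) = s(α′) and Par(α) = Par(α′) = β force the
-- new symbols to agree, and then α ≠ α′ leaves only the case where α′ is treated by FirstNonMin
-- and α is not.
--
-- Two facts exclude it.  (1) In an asymmetric bracelet w x Mᵗ with x < M the symbol x can be
-- raised, keeping an asymmetric bracelet, unless x = M − 1 and t > 0.  (2) If w has no zero, then
-- 0ᵃw (a ≥ 1) is an asymmetric bracelet iff w < wᴿ.  By (1) α′ ends in M, and by (2) α′ starts
-- with 0.
--
-- If α uses LastSymbol, then α ends in 0M, so LastNonMax was applicable by (1).  Otherwise the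
-- modified positions coincide: α = 0ᵐxu, β = 0ᵐ(x+1)u, α′ = 0ᵐ(x+2)u.  If u = Mᶜ then α′ is the root
-- or LastSymbol applies to it.  If u = Mᶜ z Mᵈ, then z = M − 1, and for x > 0 LastNonMax applies
-- to α by (2), while for x = 0 one gets d = c + 1 from α; if c = 0 then α is the root, and if c > 0
-- then LastSymbol applies to α′ when M > 2, whereas α′ is symmetric when M = 2.

open import Defs
open import Data.Empty using (⊥; ⊥-elim)
open import Data.Fin.Base as Fin using (Fin; zero; suc; toℕ; fromℕ<)
open import Data.Fin.Properties using (toℕ-injective; toℕ-fromℕ<; toℕ≤pred[n])
open import Data.List.Base using (List; []; _∷_; _++_; [_]; InitLast; _∷ʳ′_; drop; initLast; length; map; replicate; reverse; take)
open import Data.List.Properties using (++-assoc; ++-cancelˡ; ++-identityʳ; length-++; length-map; length-replicate; length-reverse; map-++; map-injective; reverse-++; reverse-involutive; reverse-map; unfold-reverse; ∷-injective; ∷-injectiveʳ; ∷-injectiveˡ)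
open import Data.List.Relation.Binary.Permutation.Propositional using (↭-sym)
open import Data.List.Relation.Binary.Permutation.Propositional.Properties using (All-resp-↭; ↭-reverse)
open import Data.List.Relation.Unary.All as All using (All; []; _∷_)
open import Data.List.Relation.Unary.All.Properties using (++⁺; ++⁻ˡ; ++⁻ʳ; replicate⁺)
open import Data.Nat.Base using (ℕ; zero; suc; _+_; _∸_; _≤_; _<_; _%_; z≤n; s≤s; z<s; s<s)
open import Data.Nat.DivMod using (m<n⇒m%n≡m; n%n≡0)
open import Data.Nat.ListAction using (sum)
open import Data.Nat.ListAction.Properties using (sum-++)
open import Data.Nat.Properties using (1+n≢n; 1+n≰n; +-assoc; +-cancelʳ-≡; +-comm; +-identityʳ; +-suc; <-asym; <-cmp; <-irrefl; <-trans; <⇒≢; <⇒≤; <⇒≱; m+n∸n≡m; m+n≡0⇒m≡0; m<n⇒m<1+n; m≤m+n; m≤n+m; m≤n⇒m<n∨m≡n; n<1+n; n≤1+n; suc-injective; ≤-<-trans; ≤-pred; ≤-refl; ≤-reflexive; ≤-trans; ≤∧≢⇒<)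
open import Data.Product.Base using (_×_; _,_; proj₁; proj₂; ∃-syntax; ∃₂)
open import Data.Sum.Base using (_⊎_; inj₁; inj₂; map₁)
open import Data.Unit.Base using (tt)
open import Data.Vec.Base as Vec using ([]; _∷_; _[_]≔_; fromList; lookup; toList)
open import Data.Vec.Properties using ([]≔-lookup; length-toList; toList-reverse; toList∘fromList)
open import Data.Vec.Relation.Binary.Lex.Strict using (base; this; next)
open import Relation.Binary.Definitions using (tri<; tri≈; tri>)
open import Relation.Binary.PropositionalEquality using (_≡_; _≢_; refl; sym; trans; cong; cong₂; subst; subst₂; module ≡-Reasoning)
open import Relation.Nullary using (¬_; contradiction)

private
  variable
    A : Set
    k n m M c t x y z : ℕ
    xs ys zs w r : List ℕ

-- Factorisations, powers and reversals of lists

++-split : (xs {ys} us {vs} : List A) → xs ++ ys ≡ us ++ vs →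
           (∃[ e ] us ≡ xs ++ e × ys ≡ e ++ vs) ⊎ (∃[ e ] xs ≡ us ++ e × vs ≡ e ++ ys)
++-split []       us       eq = inj₁ (us , refl , eq)
++-split (x ∷ xs) []       eq = inj₂ (x ∷ xs , refl , sym eq)
++-split (x ∷ xs) (u ∷ us) eq with refl , eq′ ← ∷-injective eq with ++-split xs us eq′
... | inj₁ (e , p , q) = inj₁ (e , cong (x ∷_) p , q)
... | inj₂ (e , p , q) = inj₂ (e , cong (x ∷_) p , q)

replicate-++ : ∀ m n {x : A} → replicate m x ++ replicate n x ≡ replicate (m + n) x
replicate-++ zero    n = refl
replicate-++ (suc m) n = cong (_ ∷_) (replicate-++ m n)

replicate-∷ʳ : ∀ n {x : A} → replicate n x ++ [ x ] ≡ replicate (suc n) x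
replicate-∷ʳ zero    = refl
replicate-∷ʳ (suc n) = cong (_ ∷_) (replicate-∷ʳ n)

reverse-replicate : ∀ n {x : A} → reverse (replicate n x) ≡ replicate n x
reverse-replicate zero        = refl
reverse-replicate (suc n) {x} = trans (unfold-reverse x (replicate n x))
  (trans (cong (_++ [ x ]) (reverse-replicate n)) (replicate-∷ʳ n))

replicate-split : ∀ n {x : A} us {vs} → replicate n x ≡ us ++ vs →
                  ∃₂ λ i j → us ≡ replicate i x × vs ≡ replicate j x × n ≡ i + j
replicate-split n       []       eq = 0 , n , refl , sym eq , refl
replicate-split (suc n) (u ∷ us) eq with refl , eq′ ← ∷-injective eq with replicate-split n us eq′
... | i , j , p , q , r = suc i , j , cong (_ ∷_) p , q , cong suc r

all≡⇒replicate : {x : A} {us : List A} → All (_≡ x) us → us ≡ replicate (length us) x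
all≡⇒replicate []         = refl
all≡⇒replicate (refl ∷ p) = cong (_ ∷_) (all≡⇒replicate p)

reverse-middle : ∀ (us : List A) x vs → reverse (us ++ x ∷ vs) ≡ reverse vs ++ x ∷ reverse us
reverse-middle us x vs = begin
  reverse (us ++ x ∷ vs)              ≡⟨ reverse-++ us (x ∷ vs) ⟩
  reverse (x ∷ vs) ++ reverse us      ≡⟨ cong (_++ reverse us) (unfold-reverse x vs) ⟩
  (reverse vs ++ [ x ]) ++ reverse us ≡⟨ ++-assoc (reverse vs) [ x ] (reverse us) ⟩
  reverse vs ++ x ∷ reverse us        ∎
  where open ≡-Reasoning

reverse⁺ : {P : A → Set} {us : List A} → All P us → All P (reverse us)
reverse⁺ {us = us} = All-resp-↭ (↭-sym (↭-reverse us))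

-- Both words are rotations of `x ∷ r ++ w`. The cut comes from the stretch `e` by which one of `r`,
-- `r′` exceeds the other.
conjugate : ∀ (w r w′ r′ : List A) {x} → r ++ w ≡ r′ ++ w′ →
            ∃₂ λ u v → w ++ x ∷ r ≡ u ++ v × w′ ++ x ∷ r′ ≡ v ++ u
conjugate w r w′ r′ {x} eq with ++-split r r′ eq
... | inj₁ (e , refl , refl) = e , w′ ++ x ∷ r , ++-assoc e w′ (x ∷ r) , sym (++-assoc w′ (x ∷ r) e)
... | inj₂ (e , refl , refl) = w ++ x ∷ r′ , e , sym (++-assoc w (x ∷ r′) e) , ++-assoc e w (x ∷ r′)

-- Lexicographic order

infix 4 _<ₗ_ _≤ₗ_

-- Only strings of equal length get compared, so there is no clause for proper prefixes.
data _<ₗ_ : List ℕ → List ℕ → Set where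
  here  : x < y → x ∷ xs <ₗ y ∷ ys
  there : xs <ₗ ys → x ∷ xs <ₗ x ∷ ys

_≤ₗ_ : List ℕ → List ℕ → Set
xs ≤ₗ ys = xs ≡ ys ⊎ xs <ₗ ys

<ₗ-irrefl : ¬ xs <ₗ xs
<ₗ-irrefl (here x<x) = <-irrefl refl x<x
<ₗ-irrefl (there lt) = <ₗ-irrefl lt

<ₗ-asym : xs <ₗ ys → ¬ ys <ₗ xs
<ₗ-asym (here p)  (here q)  = <-asym p q
<ₗ-asym (here p)  (there _) = <-irrefl refl p
<ₗ-asym (there _) (here q)  = <-irrefl refl q
<ₗ-asym (there p) (there q) = <ₗ-asym p q

<ₗ-respʳ : ys ≡ zs → xs <ₗ ys → xs <ₗ zs
<ₗ-respʳ refl p = p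

≤ₗ-antisym : xs ≤ₗ ys → ys ≤ₗ xs → xs ≡ ys
≤ₗ-antisym (inj₁ eq) _         = eq
≤ₗ-antisym (inj₂ _)  (inj₁ eq) = sym eq
≤ₗ-antisym (inj₂ p)  (inj₂ q)  = ⊥-elim (<ₗ-asym p q)

≤ₗ-there : xs ≤ₗ ys → x ∷ xs ≤ₗ x ∷ ys
≤ₗ-there (inj₁ refl) = inj₁ refl
≤ₗ-there (inj₂ p)    = inj₂ (there p)

≤ₗ-head : x ∷ xs ≤ₗ y ∷ ys → x ≤ y
≤ₗ-head (inj₁ refl)      = ≤-refl
≤ₗ-head (inj₂ (here p))  = <⇒≤ p
≤ₗ-head (inj₂ (there _)) = ≤-refl

<ₗ-uncons : x ∷ xs <ₗ y ∷ ys → x < y ⊎ (x ≡ y × xs <ₗ ys)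
<ₗ-uncons (here p)  = inj₁ p
<ₗ-uncons (there p) = inj₂ (refl , p)

<ₗ-tail : x ∷ xs <ₗ x ∷ ys → xs <ₗ ys
<ₗ-tail (here p)  = ⊥-elim (<-irrefl refl p)
<ₗ-tail (there p) = p

++-monoʳ-<ₗ : ∀ zs → xs <ₗ ys → zs ++ xs <ₗ zs ++ ys
++-monoʳ-<ₗ []       p = p
++-monoʳ-<ₗ (z ∷ zs) p = there (++-monoʳ-<ₗ zs p)

++-cancelˡ-<ₗ : ∀ zs → zs ++ xs <ₗ zs ++ ys → xs <ₗ ys
++-cancelˡ-<ₗ []       p = p
++-cancelˡ-<ₗ (z ∷ zs) p = ++-cancelˡ-<ₗ zs (<ₗ-tail p)

++-cancelˡ-≤ₗ : ∀ zs → zs ++ xs ≤ₗ zs ++ ys → xs ≤ₗ ys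
++-cancelˡ-≤ₗ zs (inj₁ eq) = inj₁ (++-cancelˡ zs _ _ eq)
++-cancelˡ-≤ₗ zs (inj₂ p)  = inj₂ (++-cancelˡ-<ₗ zs p)

++-cancelʳ-<ₗ : ∀ xs ys → length xs ≡ length ys → xs ++ zs <ₗ ys ++ zs → xs <ₗ ys
++-cancelʳ-<ₗ []       []       eq p         = ⊥-elim (<ₗ-irrefl p)
++-cancelʳ-<ₗ (x ∷ xs) (y ∷ ys) eq (here p)  = here p
++-cancelʳ-<ₗ (x ∷ xs) (y ∷ ys) eq (there p) = there (++-cancelʳ-<ₗ xs ys (suc-injective eq) p)

<ₗ⇒0<length : xs <ₗ ys → 0 < length xs
<ₗ⇒0<length (here _)  = z<s
<ₗ⇒0<length (there _) = z<s

replicate-maximal : ∀ {M} t → All (_≤ M) ys → ¬ replicate t M <ₗ ys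
replicate-maximal (suc t) (y≤M ∷ _) (here p)  = <⇒≱ p y≤M
replicate-maximal (suc t) (_ ∷ ps)  (there p) = replicate-maximal t ps p

-- Asymmetric bracelets as words over ℕ

-- The rotations of l = uv are the strings vu, and those of its reversal the strings uᴿvᴿ.
IsAB : List ℕ → Set
IsAB l = ∀ u v → l ≡ u ++ v → (l ≤ₗ v ++ u) × (l <ₗ reverse u ++ reverse v)

conjugate-unique : ∀ u v → IsAB (u ++ v) → IsAB (v ++ u) → u ++ v ≡ v ++ u
conjugate-unique u v p q = ≤ₗ-antisym (proj₁ (p u v refl)) (proj₁ (q v u refl))

-- Every symbol starts some rotation, and no rotation is below the word.
head-minimal : IsAB (x ∷ xs) → All (x ≤_) (x ∷ xs)
head-minimal {x} {xs} ab = go [] (x ∷ xs) refl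
  where
  go : ∀ us vs → x ∷ xs ≡ us ++ vs → All (x ≤_) vs
  go us []       eq = []
  go us (v ∷ vs) eq = ≤ₗ-head (proj₁ (ab us (v ∷ vs) eq)) ∷ go (us ++ [ v ]) vs (trans eq (sym (++-assoc us [ v ] vs)))

-- Cutting after the zeros shows that `0ᵃwᴿ` is a rotation of the reversal; the common prefix
-- cancels.
IsAB-0ᵃw⇒w<wᴿ : ∀ a w → IsAB (replicate a 0 ++ w) → w <ₗ reverse w
IsAB-0ᵃw⇒w<wᴿ a w ab = ++-cancelˡ-<ₗ (replicate a 0)
  (<ₗ-respʳ (cong (_++ reverse w) (reverse-replicate a)) (proj₂ (ab (replicate a 0) w refl)))

IsAB-pM⇒p<pᴿ : ∀ p x → IsAB (p ++ [ x ]) → p <ₗ reverse p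
IsAB-pM⇒p<pᴿ p x ab = ++-cancelʳ-<ₗ p (reverse p) (sym (length-reverse p)) (proj₂ (ab p [ x ] refl))

0∷-minimal : ∀ e {f h} → All (0 <_) e → 0 < length e → 0 ∷ f <ₗ e ++ h
0∷-minimal (_ ∷ _) (p ∷ _) _ = here p

-- A competitor matches all leading zeros only if it is the word itself or the zeros followed by
-- `wᴿ`. Any other one shows a positive symbol where the word still has 0. The cut lies in `w` or
-- among the zeros.
w<wᴿ⇒IsAB-0ᵃw : ∀ a w → All (0 <_) w → w <ₗ reverse w → IsAB (replicate (suc a) 0 ++ w)
w<wᴿ⇒IsAB-0ᵃw a w pos w<wᴿ u v eq with ++-split (replicate (suc a) 0) u eq
... | inj₁ (w₁ , refl , refl) = rot v (++⁻ʳ w₁ pos) , rev w₁ w<wᴿ (++⁻ˡ w₁ pos)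
  where
  O = replicate (suc a) 0
  rot : ∀ w₂ → All (0 <_) w₂ → O ++ w₁ ++ w₂ ≤ₗ w₂ ++ O ++ w₁
  rot []       _       = inj₁ (cong (O ++_) (++-identityʳ w₁))
  rot (y ∷ _)  (p ∷ _) = inj₂ (here p)
  rev : ∀ w₁ → w₁ ++ v <ₗ reverse (w₁ ++ v) → All (0 <_) w₁ → O ++ w₁ ++ v <ₗ reverse (O ++ w₁) ++ reverse v
  rev []         lt _ = <ₗ-respʳ (cong (_++ reverse v)
    (sym (trans (cong reverse (++-identityʳ O)) (reverse-replicate (suc a))))) (++-monoʳ-<ₗ O lt)
  rev w₁@(_ ∷ _) lt p = <ₗ-respʳ
    (sym (trans (cong (_++ reverse v) (reverse-++ O w₁)) (++-assoc (reverse w₁) (reverse O) (reverse v))))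
    (0∷-minimal (reverse w₁) (reverse⁺ p) (subst (0 <_) (sym (length-reverse w₁)) z<s))
... | inj₂ (e , eq₁ , refl) with replicate-split (suc a) u eq₁
... | i , j , refl , refl , a≡i+j = rot i j (trans a≡i+j (+-comm i j)) , rev i j a≡i+j
  where
  -- A word below its reversal is not empty, so there is a positive symbol to meet.
  0<∣w∣ : 0 < length w
  0<∣w∣ = <ₗ⇒0<length w<wᴿ
  regroup : ∀ i j → suc a ≡ i + j → replicate i 0 ++ replicate j 0 ++ w ≡ replicate (suc a) 0 ++ w
  regroup i j eq = trans (sym (++-assoc (replicate i 0) (replicate j 0) w))
    (cong (_++ w) (trans (replicate-++ i j) (cong (λ n → replicate n 0) (sym eq))))
  rot : ∀ i j → suc a ≡ j + i → replicate (suc a) 0 ++ w ≤ₗ (replicate j 0 ++ w) ++ replicate i 0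
  rot zero    j eq = inj₁ (trans (sym (regroup j 0 eq)) (sym (++-identityʳ (replicate j 0 ++ w))))
  rot (suc i) j eq = inj₂ (subst₂ _<ₗ_ (regroup j (suc i) eq) (sym (++-assoc (replicate j 0) w _))
    (++-monoʳ-<ₗ (replicate j 0) (0∷-minimal w pos 0<∣w∣)))
  rev : ∀ i j → suc a ≡ i + j →
        replicate (suc a) 0 ++ w <ₗ reverse (replicate i 0) ++ reverse (replicate j 0 ++ w)
  rev i zero    eq = subst₂ _<ₗ_ (regroup i 0 eq) (cong (_++ reverse w) (sym (reverse-replicate i)))
    (++-monoʳ-<ₗ (replicate i 0) w<wᴿ)
  rev i (suc j) eq = subst₂ _<ₗ_ (regroup i (suc j) eq)
    (cong₂ _++_ (sym (reverse-replicate i)) (sym (reverse-++ (replicate (suc j) 0) w)))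
    (++-monoʳ-<ₗ (replicate i 0)
      (0∷-minimal (reverse w) (reverse⁺ pos) (subst (0 <_) (sym (length-reverse w)) 0<∣w∣)))

-- A difference before both displayed `x` survives. If the right `x` stands against a symbol of `w`,
-- raising it only helps. If the two are aligned after equal prefixes, the assumed inequality fails,
-- since `replicate t M` is maximal. If an `M` stands against the left `x`, then `suc x < M`
-- decides.
raise-<ₗ : ∀ {M} w {t} c m {d} → length c ≤ length w → All (_≤ M) d → m ≡ 0 ⊎ suc x < M →
           w ++ x ∷ replicate t M <ₗ c ++ replicate m M ++ x ∷ d →
           w ++ suc x ∷ replicate t M <ₗ c ++ replicate m M ++ suc x ∷ d
raise-<ₗ []      []      zero    _       d≤M _        lt        = ⊥-elim (replicate-maximal _ d≤M (<ₗ-tail lt))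
raise-<ₗ []      []      (suc m) _       d≤M (inj₂ p) _         = here p
raise-<ₗ (_ ∷ w) []      zero    _       d≤M _        (here p)  = here (m<n⇒m<1+n p)
raise-<ₗ (_ ∷ w) []      zero    _       d≤M _        (there _) = here (n<1+n _)
raise-<ₗ (_ ∷ w) []      (suc m) _       d≤M _        (here p)  = here p
raise-<ₗ (_ ∷ w) []      (suc m) _       d≤M (inj₂ p) (there q) = there (raise-<ₗ w [] m z≤n d≤M (inj₂ p) q)
raise-<ₗ (_ ∷ w) (_ ∷ c) m       _       d≤M _        (here p)  = here p
raise-<ₗ (_ ∷ w) (_ ∷ c) m       (s≤s l) d≤M h        (there q) = there (raise-<ₗ w c m l d≤M h q)

-- The companion of `raise-<ₗ` for equality: either the right side is raised at an earlier index, or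
-- the raised symbols are aligned.
raise-≡ : ∀ w {r} c {d} → length c ≤ length w → w ++ x ∷ r ≡ c ++ x ∷ d →
          w ++ suc x ∷ r ≤ₗ c ++ suc x ∷ d
raise-≡ []      []      _       eq = inj₁ (cong (_ ∷_) (∷-injectiveʳ eq))
raise-≡ (_ ∷ w) []      _       eq = inj₂ (here (s≤s (≤-reflexive (∷-injectiveˡ eq))))
raise-≡ (_ ∷ w) (_ ∷ c) (s≤s l) eq with refl , eq′ ← ∷-injective eq = ≤ₗ-there (raise-≡ w c l eq′)

-- Fact (1). A rotation cut in `w` has its raised symbol no later than the word does; in a reversal
-- a run of maxima may precede it, which the last hypothesis handles. A rotation cut inside the
-- final block starts with `M`.
raise-IsAB : ∀ {M} w {t} → IsAB (w ++ x ∷ replicate t M) → All (_≤ M) w → x < M → t ≡ 0 ⊎ suc x < M →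
             IsAB (w ++ suc x ∷ replicate t M)
raise-IsAB {x} {M} w {t} ab w≤M x<M gap = split
  where
  T = replicate t M
  t≤M : ∀ i → All (_≤ M) (replicate i M)
  t≤M i = replicate⁺ i ≤-refl
  rot : ∀ {u} e → w ≡ u ++ e → w ++ suc x ∷ T ≤ₗ (e ++ suc x ∷ T) ++ u
  rot {u} e refl = subst (w ++ suc x ∷ T ≤ₗ_) (sym (++-assoc e (suc x ∷ T) u))
    (go (subst (w ++ x ∷ T ≤ₗ_) (++-assoc e (x ∷ T) u)
      (proj₁ (ab u (e ++ x ∷ T) (++-assoc u e (x ∷ T))))))
    where
    ∣e∣≤∣w∣ : length e ≤ length w
    ∣e∣≤∣w∣ = subst (length e ≤_) (sym (length-++ u)) (m≤n+m (length e) (length u))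
    go : w ++ x ∷ T ≤ₗ e ++ x ∷ (T ++ u) → w ++ suc x ∷ T ≤ₗ e ++ suc x ∷ (T ++ u)
    go (inj₁ eq) = raise-≡ w e ∣e∣≤∣w∣ eq
    go (inj₂ lt) = inj₂ (raise-<ₗ w e 0 ∣e∣≤∣w∣ (++⁺ (t≤M t) (++⁻ˡ u w≤M)) (inj₁ refl) lt)
  reversed : ∀ {x} e i → reverse (e ++ x ∷ replicate i M) ≡ replicate i M ++ x ∷ reverse e
  reversed {x} e i = trans (reverse-middle e x (replicate i M)) (cong (_++ x ∷ reverse e) (reverse-replicate i))
  rev : ∀ {u} e → w ≡ u ++ e → w ++ suc x ∷ T <ₗ reverse u ++ reverse (e ++ suc x ∷ T)
  rev {u} e refl = <ₗ-respʳ (cong (reverse u ++_) (sym (reversed e t)))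
    (raise-<ₗ w (reverse u) t
      (subst₂ _≤_ (sym (length-reverse u)) (sym (length-++ u)) (m≤m+n (length u) (length e)))
      (reverse⁺ (++⁻ʳ u w≤M)) gap
      (<ₗ-respʳ (cong (reverse u ++_) (reversed e t)) (proj₂ (ab u (e ++ x ∷ T) (++-assoc u e (x ∷ T))))))
  rev′ : ∀ i j → t ≡ i + j → w ++ suc x ∷ T <ₗ reverse (w ++ suc x ∷ replicate i M) ++ reverse (replicate j M)
  rev′ i j t≡i+j = <ₗ-respʳ (sym (shape (suc x)))
    (raise-<ₗ w [] i z≤n (++⁺ (reverse⁺ w≤M) (t≤M j)) gap′
      (<ₗ-respʳ (shape x) (proj₂ (ab (w ++ x ∷ replicate i M) (replicate j M)
        (trans (cong (λ f → w ++ x ∷ f) (trans (cong (λ n → replicate n M) t≡i+j) (sym (replicate-++ i j))))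
               (sym (++-assoc w (x ∷ replicate i M) (replicate j M))))))))
    where
    shape : ∀ x → reverse (w ++ x ∷ replicate i M) ++ reverse (replicate j M) ≡ replicate i M ++ x ∷ (reverse w ++ replicate j M)
    shape x = trans (cong₂ _++_ (reversed w i) (reverse-replicate j)) (++-assoc (replicate i M) (x ∷ reverse w) (replicate j M))
    gap′ : i ≡ 0 ⊎ suc x < M
    gap′ = map₁ (λ t≡0 → m+n≡0⇒m≡0 i (trans (sym t≡i+j) t≡0)) gap
  -- For empty `w` the first symbol is `suc x`, and a nonempty final block forces `suc x < M`.
  -- Otherwise it is at most `x` by `head-minimal`.
  head<M : ∀ w → IsAB (w ++ x ∷ T) → t ≡ 0 ⊎ suc x < M → ∀ {f g j} → t ≡ suc j → w ++ suc x ∷ f <ₗ M ∷ g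
  head<M []      ab (inj₁ refl) ()
  head<M []      ab (inj₂ p)    _ = here p
  head<M (h ∷ w) ab _           _ with h≤x ∷ _ ← ++⁻ʳ (h ∷ w) (head-minimal ab) = here (≤-<-trans h≤x x<M)
  split : ∀ u v → w ++ suc x ∷ T ≡ u ++ v → (w ++ suc x ∷ T ≤ₗ v ++ u) × (w ++ suc x ∷ T <ₗ reverse u ++ reverse v)
  split u v eq with ++-split w u eq
  ... | inj₂ (e , p , refl) = rot e p , rev e p
  -- A cut right before the raised symbol is a cut of `w` with empty remainder.
  ... | inj₁ ([] , p , refl) = rot [] eq′ , rev [] eq′
    where
    eq′ = sym (trans (++-identityʳ u) (trans p (++-identityʳ w)))
  ... | inj₁ (_ ∷ e , refl , eq₁) with refl , eq₂ ← ∷-injective eq₁ with replicate-split t e eq₂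
  ... | i , j , refl , refl , t≡i+j = rot′ j t≡i+j , rev′ i j t≡i+j
    where
    rot′ : ∀ j → t ≡ i + j → w ++ suc x ∷ T ≤ₗ replicate j M ++ w ++ suc x ∷ replicate i M
    rot′ zero    eq = inj₁ (cong (λ n → w ++ suc x ∷ replicate n M) (trans eq (+-identityʳ i)))
    rot′ (suc j) eq = inj₂ (head<M w ab gap (trans eq (+-suc i j)))

-- Strings and their symbols

symbols : Str k n → List ℕ
symbols α = map toℕ (toList α)

symbols-injective : (α β : Str k n) → symbols α ≡ symbols β → α ≡ β
symbols-injective []      []      _  = refl
symbols-injective (a ∷ α) (b ∷ β) eq with p , q ← ∷-injective eq =
  cong₂ _∷_ (toℕ-injective p) (symbols-injective α β q)

symbols-reverse : (α : Str k n) → symbols (Vec.reverse α) ≡ reverse (symbols α)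
symbols-reverse α = trans (cong (map toℕ) (toList-reverse α)) (reverse-map toℕ (toList α))

length-symbols : (α : Str k n) → length (symbols α) ≡ n
length-symbols α = trans (length-map toℕ (toList α)) (length-toList α)

symbols≤ : (α : Str (suc M) n) → All (_≤ M) (symbols α)
symbols≤ []      = []
symbols≤ (a ∷ α) = toℕ≤pred[n] a ∷ symbols≤ α

≼⇒≤ₗ : (α β : Str k n) → α ≼ β → symbols α ≤ₗ symbols β
≼⇒≤ₗ []      []      _             = inj₁ refl
≼⇒≤ₗ (a ∷ α) (b ∷ β) (this a<b _)  = inj₂ (here a<b)
≼⇒≤ₗ (a ∷ α) (b ∷ β) (next refl p) = ≤ₗ-there (≼⇒≤ₗ α β p)

≤ₗ⇒≼ : (α β : Str k n) → symbols α ≤ₗ symbols β → α ≼ β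
≤ₗ⇒≼ []      []      _          = base tt
≤ₗ⇒≼ (a ∷ α) (b ∷ β) (inj₁ eq) with p , q ← ∷-injective eq =
  next (toℕ-injective p) (≤ₗ⇒≼ α β (inj₁ q))
≤ₗ⇒≼ (a ∷ α) (b ∷ β) (inj₂ lt) with <ₗ-uncons lt
... | inj₁ a<b     = this a<b refl
... | inj₂ (p , q) = next (toℕ-injective p) (≤ₗ⇒≼ α β (inj₂ q))

map-split : {B : Set} (f : A → B) (xs : List A) (us : List B) {vs : List B} → map f xs ≡ us ++ vs →
            ∃₂ λ us′ vs′ → xs ≡ us′ ++ vs′ × map f us′ ≡ us × map f vs′ ≡ vs
map-split f xs       []       eq = [] , xs , refl , refl , eq
map-split f (x ∷ xs) (u ∷ us) eq with refl , eq′ ← ∷-injective eq with map-split f xs us eq′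
... | us′ , vs′ , p , q , r = x ∷ us′ , vs′ , cong (x ∷_) p , cong (_ ∷_) q , r

∈[]⇒conjugate : (α β : Str k n) → β ∈[ α ] → ∃₂ λ u v → symbols α ≡ u ++ v × symbols β ≡ v ++ u
∈[]⇒conjugate α β (u , v , p , q) = map toℕ u , map toℕ v ,
  trans (cong (map toℕ) p) (map-++ toℕ u v) , trans (cong (map toℕ) q) (map-++ toℕ v u)

conjugate⇒∈[] : (α β : Str k n) → ∀ u v → symbols α ≡ u ++ v → symbols β ≡ v ++ u → β ∈[ α ]
conjugate⇒∈[] α β u v p q with u′ , v′ , eq , refl , refl ← map-split toℕ (toList α) u p =
  u′ , v′ , eq , map-injective toℕ-injective (trans q (sym (map-++ toℕ v′ u′)))

fromSymbols : (xs : List (Fin k)) → length xs ≡ n → ∃[ α ] symbols {k} {n} α ≡ map toℕ xs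
fromSymbols xs refl = fromList xs , cong (map toℕ) (toList∘fromList xs)

rotate : (α : Str k n) → ∀ u v → symbols α ≡ u ++ v → ∃[ β ] symbols {k} {n} β ≡ v ++ u
rotate {n = n} α u v eq with u′ , v′ , p , refl , refl ← map-split toℕ (toList α) u eq =
  proj₁ β , trans (proj₂ β) (map-++ toℕ v′ u′)
  where
  len : length (v′ ++ u′) ≡ n
  len = begin
    length (v′ ++ u′)      ≡⟨ length-++ v′ ⟩
    length v′ + length u′  ≡⟨ +-comm (length v′) (length u′) ⟩
    length u′ + length v′  ≡⟨ length-++ u′ ⟨
    length (u′ ++ v′)      ≡⟨ cong length p ⟨
    length (toList α)      ≡⟨ length-toList α ⟩
    n                      ∎
    where open ≡-Reasoning
  β = fromSymbols {n = n} (v′ ++ u′) len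

∈[]-refl : (α : Str k n) → α ∈[ α ]
∈[]-refl α = [] , toList α , refl , sym (++-identityʳ (toList α))

-- Minimality gives `≤ₗ` against both kinds of competitor. Equality with a rotation of the reversal
-- would make `α` symmetric, which sharpens the second comparison to `<ₗ`.
AsymBracelet⇒IsAB : (α : Str k n) → AsymBracelet α → IsAB (symbols α)
AsymBracelet⇒IsAB α ((_ , min) , asym) u v eq = rot , rev
  where
  rot : symbols α ≤ₗ v ++ u
  rot with β , p ← rotate α u v eq =
    subst (symbols α ≤ₗ_) p (≼⇒≤ₗ α β (min β (inj₁ (conjugate⇒∈[] α β u v eq p))))
  eqᴿ : symbols (Vec.reverse α) ≡ reverse v ++ reverse u
  eqᴿ = trans (symbols-reverse α) (trans (cong reverse eq) (reverse-++ u v))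
  rev : symbols α <ₗ reverse u ++ reverse v
  rev with β , p ← rotate (Vec.reverse α) (reverse v) (reverse u) eqᴿ
    with ≼⇒≤ₗ α β (min β (inj₂ (conjugate⇒∈[] (Vec.reverse α) β (reverse v) (reverse u) eqᴿ p)))
  ... | inj₁ q = contradiction (conjugate⇒∈[] α (Vec.reverse α) (reverse u) (reverse v) (trans q p) eqᴿ) asym
  ... | inj₂ q = <ₗ-respʳ p q

IsAB⇒AsymBracelet : (α : Str k n) → IsAB (symbols α) → AsymBracelet α
IsAB⇒AsymBracelet α ab = (inj₁ (∈[]-refl α) , min) , asym
  where
  min : ∀ β → β ∈[ α ] ⊎ β ∈[ Vec.reverse α ] → α ≼ β
  min β (inj₁ r) with u , v , p , q ← ∈[]⇒conjugate α β r =
    ≤ₗ⇒≼ α β (subst (symbols α ≤ₗ_) (sym q) (proj₁ (ab u v p)))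
  -- A rotation `vu` of the reversal `uv` is the reversed competitor for the cut `vᴿ`, `uᴿ` of `α`.
  min β (inj₂ r) with u , v , p , q ← ∈[]⇒conjugate (Vec.reverse α) β r =
    ≤ₗ⇒≼ α β (inj₂ (<ₗ-respʳ
      (trans (cong₂ _++_ (reverse-involutive v) (reverse-involutive u)) (sym q))
      (proj₂ (ab (reverse v) (reverse u) (begin
        symbols α                     ≡⟨ reverse-involutive (symbols α) ⟨
        reverse (reverse (symbols α)) ≡⟨ cong reverse (trans (sym (symbols-reverse α)) p) ⟩
        reverse (u ++ v)              ≡⟨ reverse-++ u v ⟩
        reverse v ++ reverse u        ∎)))))
    where open ≡-Reasoning
  asym : ¬ IsSymmetric α
  -- If the reversal is the rotation `vu`, then the competitor `uᴿvᴿ` is `α` itself.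
  asym r with u , v , p , q ← ∈[]⇒conjugate α (Vec.reverse α) r =
    <ₗ-irrefl (<ₗ-respʳ (begin
      reverse u ++ reverse v        ≡⟨ reverse-++ v u ⟨
      reverse (v ++ u)              ≡⟨ cong reverse (trans (sym q) (symbols-reverse α)) ⟩
      reverse (reverse (symbols α)) ≡⟨ reverse-involutive (symbols α) ⟩
      symbols α                     ∎) (proj₂ (ab u v p)))
    where open ≡-Reasoning

-- Splitting a string at a position

before after : Str k n → Fin n → List ℕ
before α p = map toℕ (take (toℕ p) (toList α))
after  α p = map toℕ (drop (suc (toℕ p)) (toList α))

toList-[]≔ : (α : Str k n) (p : Fin n) (y : Fin k) →
             toList (α [ p ]≔ y) ≡ take (toℕ p) (toList α) ++ y ∷ drop (suc (toℕ p)) (toList α)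
toList-[]≔ (a ∷ α) zero    y = refl
toList-[]≔ (a ∷ α) (suc p) y = cong (a ∷_) (toList-[]≔ α p y)

toList-lookup : (α : Str k n) (p : Fin n) →
                toList α ≡ take (toℕ p) (toList α) ++ lookup α p ∷ drop (suc (toℕ p)) (toList α)
toList-lookup α p = trans (cong toList (sym ([]≔-lookup α p))) (toList-[]≔ α p (lookup α p))

symbols-[]≔ : (α : Str k n) (p : Fin n) (y : Fin k) → symbols (α [ p ]≔ y) ≡ before α p ++ toℕ y ∷ after α p
symbols-[]≔ α p y = trans (cong (map toℕ) (toList-[]≔ α p y)) (map-++ toℕ (take (toℕ p) (toList α)) _)

symbols-lookup : (α : Str k n) (p : Fin n) → symbols α ≡ before α p ++ toℕ (lookup α p) ∷ after α p
symbols-lookup α p = trans (cong (map toℕ) (toList-lookup α p)) (map-++ toℕ (take (toℕ p) (toList α)) _)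

symbols-s : (α : Str k n) (p : Fin n) → map toℕ (s α p) ≡ after α p ++ before α p
symbols-s α p = map-++ toℕ (drop (suc (toℕ p)) (toList α)) _

symbols-all : (P : ℕ → Set) (α : Str k n) → (∀ m → P (toℕ (lookup α m))) → All P (symbols α)
symbols-all P []      f = []
symbols-all P (a ∷ α) f = f zero ∷ symbols-all P α (λ m → f (suc m))

before-all : (P : ℕ → Set) (α : Str k n) (p : Fin n) →
             (∀ m → m Fin.< p → P (toℕ (lookup α m))) → All P (before α p)
before-all P (a ∷ α) zero    f = []
before-all P (a ∷ α) (suc p) f = f zero z<s ∷ before-all P α p (λ m m<p → f (suc m) (s≤s m<p))

after-all : (P : ℕ → Set) (α : Str k n) (p : Fin n) →
            (∀ m → p Fin.< m → P (toℕ (lookup α m))) → All P (after α p)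
after-all P (a ∷ α) zero    f = symbols-all P α (λ m → f (suc m) z<s)
after-all P (a ∷ α) (suc p) f = after-all P α p (λ m p<m → f (suc m) (s≤s p<m))

symbols-all⁻ : {P : ℕ → Set} (α : Str k n) → All P (symbols α) → ∀ m → P (toℕ (lookup α m))
symbols-all⁻ (a ∷ α) (p ∷ _)  zero    = p
symbols-all⁻ (a ∷ α) (_ ∷ ps) (suc m) = symbols-all⁻ α ps m

after-all⁻ : {P : ℕ → Set} (α : Str k n) (p : Fin n) → All P (after α p) →
             ∀ m → p Fin.< m → P (toℕ (lookup α m))
after-all⁻ (a ∷ α) zero    ps (suc m) _         = symbols-all⁻ α ps m
after-all⁻ (a ∷ α) (suc p) ps (suc m) (s≤s p<m) = after-all⁻ α p ps m p<m

position : (α : Str k n) → symbols α ≡ w ++ x ∷ r →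
           ∃[ p ] toℕ p ≡ length w × before α p ≡ w × toℕ (lookup α p) ≡ x × after α p ≡ r
position {w = []}    (a ∷ α) eq with refl , refl ← ∷-injective eq = zero , refl , refl , refl , refl
position {w = _ ∷ w} (a ∷ α) eq with refl , eq′ ← ∷-injective eq with position {w = w} α eq′
... | p , l , b , c , d = suc p , cong suc l , cong (_ ∷_) b , c , d

-- Criteria for `LastNonMax` and `LastSymbol` to act

yieldsLastNonMax : (α : Str (suc M) n) → symbols α ≡ w ++ x ∷ replicate t M → x < M →
                   IsAB (w ++ suc x ∷ replicate t M) → YieldsAsymBracelet LastNonMax α
yieldsLastNonMax {M} {t = t} α eq x<M ab with p , _ , refl , refl , eq₁ ← position α eq =
  p , α [ p ]≔ b , ((<⇒≢ x<M , after-all⁻ {P = _≡ M} α p (subst (All _) (sym eq₁) (replicate⁺ t refl))) , b , b≡ , refl) ,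
  IsAB⇒AsymBracelet _ (subst IsAB (sym (trans (symbols-[]≔ α p b)
    (cong₂ (λ e f → before α p ++ e ∷ f) b≡ eq₁))) ab)
  where
  b  = fromℕ< (s≤s x<M)
  b≡ = toℕ-fromℕ< (s≤s x<M)

-- Fact (1) for strings; its contrapositive restricts the endings on which `LastNonMax` fails.
raise-yields : (α : Str (suc M) n) → AsymBracelet α → symbols α ≡ w ++ x ∷ replicate t M → x < M →
               t ≡ 0 ⊎ suc x < M → YieldsAsymBracelet LastNonMax α
raise-yields {w = w} α ab eq x<M gap = yieldsLastNonMax α eq x<M
  (raise-IsAB w (subst IsAB eq (AsymBracelet⇒IsAB α ab)) (++⁻ˡ w (subst (All _) eq (symbols≤ α))) x<M gap)

sucMod-max : (a : Fin (suc M)) → IsMax a → toℕ (sucMod a) ≡ 0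
sucMod-max {M} a a≡M = trans (toℕ-fromℕ< _) (trans (cong (λ m → suc m % suc M) a≡M) (n%n≡0 (suc M)))

-- The last `M` wraps to 0 and the result rotates to `0 ∷ w`, which is smallest among its rotations
-- and so is the required necklace.
yieldsLastSymbol : (α : Str (suc M) n) → symbols α ≡ w ++ [ M ] → IsAB (0 ∷ w) → YieldsAsymBracelet LastSymbol α
yieldsLastSymbol {M} {n} {w} α eq ab with p , l , b , c , d ← position {w = w} α eq =
  p , γ , (last , ((∈[]-refl γ , λ β r → proj₂ (proj₁ abγ) β (inj₁ r)) , conjugate⇒∈[] α′ γ w [ 0 ] α′-sym γ-sym)) , abγ
  where
  α′ = α [ p ]≔ sucMod (lookup α p)
  α′-sym : symbols α′ ≡ w ++ [ 0 ]
  α′-sym = trans (symbols-[]≔ α p (sucMod (lookup α p)))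
    (cong₂ _++_ b (cong₂ _∷_ (sucMod-max (lookup α p) c) d))
  γ = proj₁ (rotate α′ w [ 0 ] α′-sym)
  γ-sym : symbols γ ≡ 0 ∷ w
  γ-sym = proj₂ (rotate α′ w [ 0 ] α′-sym)
  abγ : AsymBracelet γ
  abγ = IsAB⇒AsymBracelet γ (subst IsAB (sym γ-sym) ab)
  last : suc (toℕ p) ≡ n
  last = begin
    suc (toℕ p)          ≡⟨ cong suc l ⟩
    suc (length w)       ≡⟨ +-comm 1 (length w) ⟩
    length w + 1         ≡⟨ length-++ w ⟨
    length (w ++ [ M ])  ≡⟨ cong length eq ⟨
    length (symbols α)   ≡⟨ length-symbols α ⟩
    n                    ∎
    where open ≡-Reasoning

-- Strings on which neither LastNonMax nor LastSymbol acts

snoc-replicate : ∀ (u : List ℕ) x c → u ++ x ∷ replicate (suc c) M ≡ (u ++ x ∷ replicate c M) ++ [ M ]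
snoc-replicate {M} u x c = trans (cong (λ e → u ++ x ∷ e) (sym (replicate-∷ʳ c)))
  (sym (++-assoc u (x ∷ replicate c M) [ M ]))

-- For `z < M`, the shape of what follows the second-last non-maximal position; `z` is the last
-- non-maximal symbol.
blocks : ℕ → ℕ → ℕ → ℕ → List ℕ
blocks M c z d = replicate c M ++ z ∷ replicate d M

reverse-blocks : ∀ c d → reverse (blocks M c z d) ≡ blocks M d z c
reverse-blocks {M} {z} c d = trans (reverse-middle (replicate c M) z (replicate d M))
  (cong₂ (λ e f → e ++ z ∷ f) (reverse-replicate d) (reverse-replicate c))

blocks-positive : ∀ c d → 0 < M → 0 < z → All (0 <_) (blocks M c z d)
blocks-positive c d 0<M 0<z = ++⁺ (replicate⁺ c 0<M) (0<z ∷ replicate⁺ d 0<M)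

-- The first difference, at index `c`, is `z` against `M`. Taking `d′ = d` and `c′ = c` compares a
-- block word with its reversal.
blocks-< : ∀ {c d c′ d′} → z < M → c < d → blocks M c z d′ <ₗ blocks M d z c′
blocks-< {c = zero}  {d = suc d} z<M _         = here z<M
blocks-< {c = suc c} {d = suc d} z<M (s≤s c<d) = there (blocks-< z<M c<d)

blocks-<⁻ : z < M → ∀ c d → blocks M c z d <ₗ blocks M d z c → c < d
blocks-<⁻ z<M c d p with <-cmp c d
... | tri< c<d _ _  = c<d
... | tri≈ _ refl _ = ⊥-elim (<ₗ-irrefl p)
... | tri> _ _ d<c  = ⊥-elim (<ₗ-asym p (blocks-< z<M d<c))

isRoot : (α : Str (suc M) n) → symbols α ≡ replicate m 0 ++ z ∷ M ∷ [] → suc z ≡ M → IsRoot α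
isRoot {M} {n} {m} α eq refl = trans eq (cong (λ i → replicate i 0 ++ _) m≡n∸2)
  where
  m≡n∸2 : m ≡ n ∸ 2
  m≡n∸2 = begin
    m                                            ≡⟨ m+n∸n≡m m 2 ⟨
    m + 2 ∸ 2                                    ≡⟨ cong (λ i → i + 2 ∸ 2) (length-replicate m) ⟨
    length (replicate m 0) + 2 ∸ 2               ≡⟨ cong (_∸ 2) (length-++ (replicate m 0)) ⟨
    length (replicate m 0 ++ _ ∷ M ∷ []) ∸ 2     ≡⟨ cong (λ e → length e ∸ 2) eq ⟨
    length (symbols α) ∸ 2                       ≡⟨ cong (_∸ 2) (length-symbols α) ⟩
    n ∸ 2                                        ∎
    where open ≡-Reasoning

-- The facts shared by strings whose parent comes from `FirstNonMin` or `SecondLastNonMax`.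
record Stuck (α : Str (suc M) n) : Set where
  field
    asymBracelet : AsymBracelet α
    ¬lastNonMax  : ¬ YieldsAsymBracelet LastNonMax α
    ¬lastSymbol  : ¬ YieldsAsymBracelet LastSymbol α

  isAB : IsAB (symbols α)
  isAB = AsymBracelet⇒IsAB α asymBracelet

open Stuck

-- Fact (1) with `t = 0`: a smaller last symbol could be raised.
ends-in-max : (α : Str (suc M) n) → AsymBracelet α → ¬ YieldsAsymBracelet LastNonMax α →
              symbols α ≡ w ++ [ x ] → x ≡ M
ends-in-max {M} {w = w} α ab ¬lnm eq with ++⁻ʳ w (subst (All (_≤ M)) eq (symbols≤ α))
... | x≤M ∷ [] with m≤n⇒m<n∨m≡n x≤M
... | inj₁ x<M = contradiction (raise-yields {t = 0} α ab eq x<M (inj₁ refl)) ¬lnm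
... | inj₂ x≡M = x≡M

-- By `head-minimal` there is no zero at all, and `α = wM`. Cancelling the last symbol gives
-- `w < wᴿ`, so `0w` is an asymmetric bracelet by fact (2) and `LastSymbol` would act.
stuck-starts-with-0 : (α : Str (suc M) n) → Stuck α → symbols α ≡ suc y ∷ r → ⊥
stuck-starts-with-0 {M} {y = y} {r} α st eq = go (initLast (suc y ∷ r)) refl
  where
  ab : IsAB (suc y ∷ r)
  ab = subst IsAB eq (isAB st)
  go : ∀ {l} → InitLast l → l ≡ suc y ∷ r → ⊥
  go (w ∷ʳ′ x) eq₁ with refl ← ends-in-max α (asymBracelet st) (¬lastNonMax st) (trans eq (sym eq₁)) =
    ¬lastSymbol st (yieldsLastSymbol α (trans eq (sym eq₁))
      (w<wᴿ⇒IsAB-0ᵃw 0 w (++⁻ˡ w (subst (All (0 <_)) (sym eq₁) (All.map (≤-trans z<s) (head-minimal ab))))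
        (IsAB-pM⇒p<pᴿ w M (subst IsAB (sym eq₁) ab))))

-- Let `v = suc x`. If `v = M`, a palindrome follows the zeros. If `v < M − 1` or `c = 0`, then `v`
-- can be raised. If `v = M − 1`, then `c = 1` gives the root, and for `c ≥ 2` wrapping the last `M`
-- leaves `vMᶜ⁻¹`, still below its reversal.
stuck-sorted : (α : Str (suc M) n) → Stuck α → ¬ IsRoot α → symbols α ≡ replicate m 0 ++ suc x ∷ replicate c M → ⊥
stuck-sorted {M} {m = m} {x} {c} α st ¬root eq with ++⁻ʳ (replicate m 0) (subst (All (_≤ M)) eq (symbols≤ α))
... | v≤M ∷ _ with m≤n⇒m<n∨m≡n v≤M
... | inj₂ refl = <ₗ-irrefl (<ₗ-respʳ (reverse-replicate (suc c))
  (IsAB-0ᵃw⇒w<wᴿ m (replicate (suc c) M) (subst IsAB eq (isAB st))))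
... | inj₁ v<M with m≤n⇒m<n∨m≡n v<M
... | inj₁ gap = ¬lastNonMax st (raise-yields {t = c} α (asymBracelet st) eq v<M (inj₂ gap))
... | inj₂ v+1≡M with c
... | zero        = ¬lastNonMax st (raise-yields {t = 0} α (asymBracelet st) eq v<M (inj₁ refl))
... | suc zero    = ¬root (isRoot {m = m} α eq v+1≡M)
... | suc (suc c) = ¬lastSymbol st (yieldsLastSymbol α (trans eq (snoc-replicate (replicate m 0) (suc x) (suc c)))
  (w<wᴿ⇒IsAB-0ᵃw m (suc x ∷ T) (z<s ∷ replicate⁺ (suc c) (<-trans z<s v<M))
    (<ₗ-respʳ (sym (trans (unfold-reverse (suc x) T) (cong (_++ [ suc x ]) (reverse-replicate (suc c))))) (here v<M))))
  where T = replicate (suc c) M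

-- Excludes that raising `α` at its second-last non-maximal symbol meets lowering `α′` at its first
-- nonzero symbol.
stuck-blocks : (α α′ : Str (suc M) n) → 2 ≤ M → Stuck α → Stuck α′ → ¬ IsRoot α → z < M → ∀ m c d x →
               symbols α  ≡ replicate (suc m) 0 ++ x ∷ blocks M c z d →
               symbols α′ ≡ replicate (suc m) 0 ++ suc (suc x) ∷ blocks M c z d → ⊥
stuck-blocks {M} {n} {z} α α′ 2≤M st st′ ¬root z<M m c d x eq eq′ with m≤n⇒m<n∨m≡n z<M | d
... | inj₁ gap   | d     = ¬lastNonMax st (raise-yields {w = replicate (suc m) 0 ++ x ∷ replicate c M} {t = d}
  α (asymBracelet st) (trans eq (sym (++-assoc (replicate (suc m) 0) (x ∷ replicate c M) _))) z<M (inj₂ gap))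
... | inj₂ _     | zero  = ¬lastNonMax st (raise-yields {w = replicate (suc m) 0 ++ x ∷ replicate c M} {t = 0}
  α (asymBracelet st) (trans eq (sym (++-assoc (replicate (suc m) 0) (x ∷ replicate c M) _))) z<M (inj₁ refl))
-- From here on `M = suc z`, and the final block has length `suc d`, so the critical case is
-- `c ≡ d`.
... | inj₂ refl | suc d = go x eq eq′
  where
  0<z : 0 < z
  0<z = ≤-pred 2≤M
  O = replicate (suc m) 0
  snoc : ∀ u c d → u ++ blocks M c z (suc d) ≡ (u ++ blocks M c z d) ++ [ M ]
  snoc u c d = trans (cong (u ++_) (snoc-replicate (replicate c M) z d)) (sym (++-assoc u (blocks M c z d) [ M ]))
  tie : ∀ c → c ≡ d → symbols α ≡ replicate (suc (suc m)) 0 ++ blocks M c z (suc d) →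
        symbols α′ ≡ O ++ 2 ∷ blocks M c z (suc d) → ⊥
  tie zero    refl eq eq′ = ¬root (isRoot {m = suc (suc m)} α eq refl)
  tie (suc c) refl eq eq′ with m≤n⇒m<n∨m≡n 2≤M
  -- Wrapping the last `M` of `α′` leaves a palindrome starting with `M` behind the 2, so `2 < M`
  -- puts the part after the zeros below its reversal.
  ... | inj₁ 2<M = ¬lastSymbol st′ (yieldsLastSymbol α′
    (trans eq′ (trans (sym (++-assoc O [ 2 ] _))
      (trans (snoc (O ++ [ 2 ]) (suc c) (suc c)) (cong (_++ [ M ]) (++-assoc O [ 2 ] _)))))
    (w<wᴿ⇒IsAB-0ᵃw (suc m) (2 ∷ W) (z<s ∷ blocks-positive (suc c) (suc c) z<s 0<z)
      (<ₗ-respʳ (sym (trans (unfold-reverse 2 W) (cong (_++ [ 2 ]) (reverse-blocks (suc c) (suc c))))) (here 2<M))))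
    where W = blocks M (suc c) z (suc c)
  -- With `M = 2` the symbol 2 joins the maxima, and a palindrome follows the zeros of `α′`.
  ... | inj₂ 2≡M = <ₗ-irrefl (<ₗ-respʳ (reverse-blocks (suc (suc c)) (suc (suc c)))
    (IsAB-0ᵃw⇒w<wᴿ (suc m) (M ∷ blocks M (suc c) z (suc (suc c)))
      (subst (λ v → IsAB (O ++ v ∷ blocks M (suc c) z (suc (suc c)))) 2≡M (subst IsAB eq′ (isAB st′)))))
  go : ∀ x → symbols α ≡ O ++ x ∷ blocks M c z (suc d) →
       symbols α′ ≡ O ++ suc (suc x) ∷ blocks M c z (suc d) → ⊥
  -- Raising `z` to `M` merges the tail into one run of maxima. It follows a positive symbol below
  -- `M`, because `α′` carries that symbol plus 2, and fact (2) applies.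
  go (suc x) eq eq′ = ¬lastNonMax st (yieldsLastNonMax {w = O ++ suc x ∷ replicate c M} {t = suc d} α
    (trans eq (sym (++-assoc O (suc x ∷ replicate c M) _))) z<M
    (subst IsAB (sym (++-assoc O (suc x ∷ replicate c M) _))
      (subst (λ e → IsAB (O ++ suc x ∷ e)) (sym (replicate-++ c (suc (suc d))))
        (w<wᴿ⇒IsAB-0ᵃw m (suc x ∷ T) (z<s ∷ replicate⁺ (c + suc (suc d)) z<s)
          (<ₗ-respʳ (sym (trans (unfold-reverse (suc x) T)
            (cong (_++ [ suc x ]) (trans (reverse-replicate (c + suc (suc d))) (cong (λ i → replicate i M) (+-suc c (suc d)))))))
            (here x<M))))))
    where
    T = replicate (c + suc (suc d)) M
    x<M : suc x < M
    x<M with p ∷ _ ← ++⁻ʳ O (subst (All (_≤ M)) eq′ (symbols≤ α′)) = ≤-trans (n≤1+n _) p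
  go zero    eq eq′ = final (m≤n⇒m<n∨m≡n (≤-pred c<1+d))
    where
    eq₀ : symbols α ≡ replicate (suc (suc m)) 0 ++ blocks M c z (suc d)
    eq₀ = trans eq (trans (sym (++-assoc O [ 0 ] _)) (cong (_++ blocks M c z (suc d)) (replicate-∷ʳ (suc m))))
    -- The symbol 0 joins the leading zeros, and fact (2) compares the tail with its reversal.
    c<1+d : c < suc d
    c<1+d = blocks-<⁻ z<M c (suc d) (<ₗ-respʳ (reverse-blocks c (suc d))
      (IsAB-0ᵃw⇒w<wᴿ (suc (suc m)) (blocks M c z (suc d)) (subst IsAB eq₀ (isAB st))))
    final : c < d ⊎ c ≡ d → ⊥
    -- Wrapping the last `M` shortens the final block to `d`, still longer than `c`.
    final (inj₁ c<d) = ¬lastSymbol st (yieldsLastSymbol α (trans eq₀ (snoc (replicate (suc (suc m)) 0) c d))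
      (w<wᴿ⇒IsAB-0ᵃw (suc (suc m)) (blocks M c z d) (blocks-positive c d z<s 0<z)
        (<ₗ-respʳ (sym (reverse-blocks c d)) (blocks-< z<M c<d))))
    final (inj₂ c≡d) = tie c c≡d eq₀ eq′

-- Conjugate pairs and the chain property

sucMod≢ : 2 ≤ k → (a : Fin k) → sucMod a ≢ a
sucMod≢ {suc M} (s≤s 1≤M) a eq with m≤n⇒m<n∨m≡n (toℕ≤pred[n] a)
... | inj₁ a<M = 1+n≢n (trans (sym (trans (toℕ-fromℕ< _) (m<n⇒m%n≡m (s≤s a<M)))) (cong toℕ eq))
... | inj₂ a≡M = <⇒≢ 1≤M (trans (sym (sucMod-max a a≡M)) (trans (cong toℕ eq) a≡M))

drop-last : (α : Str k n) (p : Fin n) → suc (toℕ p) ≡ n → drop (suc (toℕ p)) (toList α) ≡ []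
drop-last (a ∷ [])    zero    eq = refl
drop-last (a ∷ α)     (suc p) eq = drop-last α p (suc-injective eq)

-- After a substitution the cut just before `p` serves for `β` too. Under `LastSymbol`, `β` is some
-- rotation of `s α p` followed by the new symbol, and `split` locates the cut of that rotation.
joined : 2 ≤ k → (α β : Str k n) (p : Fin n) → Par α p β → Joined α p β
joined {k} 2≤k α β p par = (take (toℕ p) (toList α) , _ , toList-lookup α p , refl) , target par
  where
  substituted : ∀ y → y ≢ lookup α p → β ≡ α [ p ]≔ y →
                ∃[ y ] y ≢ lookup α p × Rotation (toList β) (y ∷ s α p)
  substituted y y≢ refl = y , y≢ , take (toℕ p) (toList α) , _ , toList-[]≔ α p y , refl
  target : Par α p β → ∃[ y ] y ≢ lookup α p × Rotation (toList β) (y ∷ s α p)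
  target (viaLastNonMax (_ , y , y≡ , eq) _) = substituted y (λ e → 1+n≢n (trans (sym y≡) (cong toℕ e))) eq
  target (viaFirstNonMin _ _ (_ , y , y≡ , eq) _) = substituted y (λ e → 1+n≢n (trans y≡ (cong toℕ (sym e)))) eq
  target (viaSecondLastNonMax _ _ _ (_ , y , y≡ , eq) _) = substituted y (λ e → 1+n≢n (trans (sym y≡) (cong toℕ e))) eq
  target (viaLastSymbol _ (last , _ , u , v , eq , β≡) _) = a , sucMod≢ 2≤k (lookup α p) ,
    subst (λ e → Rotation (toList β) (a ∷ e ++ us)) (sym (drop-last α p last)) (split (++-split us u eq′))
    where
    a = sucMod (lookup α p)
    us = take (toℕ p) (toList α)
    eq′ : us ++ [ a ] ≡ u ++ v
    eq′ = trans (cong (λ e → us ++ a ∷ e) (sym (drop-last α p last))) (trans (sym (toList-[]≔ α p a)) eq)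
    split : (∃[ e ] u ≡ us ++ e × [ a ] ≡ e ++ v) ⊎ (∃[ e ] us ≡ u ++ e × v ≡ e ++ [ a ]) →
            Rotation (toList β) (a ∷ us)
    split (inj₁ ([] , refl , refl))     = [] , _ , β≡ , trans (cong (a ∷_) (sym (++-identityʳ us))) (sym (++-identityʳ _))
    split (inj₁ (_ ∷ [] , refl , refl)) = us , [ a ] , β≡ , refl
    split (inj₂ (e , A≡ , refl))        = e , a ∷ u , trans β≡ (++-assoc e [ a ] u) , cong (a ∷_) A≡

-- The index is the symbol written at `p`. Under `LastSymbol` it is 0, because the last symbol is
-- `M` once `LastNonMax` fails.
data Move (α : Str (suc M) n) (p : Fin n) (β : Str (suc M) n) : ℕ → Set where
  lastNonMax : IsLastNonMax α p →
    symbols β ≡ before α p ++ suc (toℕ (lookup α p)) ∷ after α p →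
    Move α p β (suc (toℕ (lookup α p)))
  lastSymbol : ¬ YieldsAsymBracelet LastNonMax α → after α p ≡ [] → toℕ (lookup α p) ≡ M → Move α p β 0
  firstNonMin : Stuck α → All (_≡ 0) (before α p) → toℕ (lookup α p) ≡ suc y →
    symbols β ≡ before α p ++ y ∷ after α p → Move α p β y
  secondLastNonMax : Stuck α → IsSecondLastNonMax α p →
    symbols β ≡ before α p ++ suc (toℕ (lookup α p)) ∷ after α p →
    Move α p β (suc (toℕ (lookup α p)))

symbols-updated : (α : Str k n) (p : Fin n) {a : Fin k} → toℕ a ≡ x → ∀ {β} → β ≡ α [ p ]≔ a →
                  symbols β ≡ before α p ++ x ∷ after α p
symbols-updated α p refl refl = symbols-[]≔ α p _

sum-middle : ∀ (w : List ℕ) x r → sum (w ++ x ∷ r) ≡ x + sum (r ++ w)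
sum-middle w x r = begin
  sum (w ++ x ∷ r)       ≡⟨ sum-++ w (x ∷ r) ⟩
  sum w + (x + sum r)    ≡⟨ +-comm (sum w) (x + sum r) ⟩
  x + sum r + sum w      ≡⟨ +-assoc x (sum r) (sum w) ⟩
  x + (sum r + sum w)    ≡⟨ cong (x +_) (sum-++ r w) ⟨
  x + sum (r ++ w)       ∎
  where open ≡-Reasoning

sum-conjugate : ∀ u v → sum (u ++ v) ≡ sum (v ++ u)
sum-conjugate u v = trans (sum-++ u v) (trans (+-comm (sum u) (sum v)) (sym (sum-++ v u)))

-- Rotation preserves symbol sums, so the equation also covers `LastSymbol`. It makes the written
-- symbol depend only on `β` and `s α p`.
move : (α β : Str (suc M) n) (p : Fin n) → AsymBracelet α → Par α p β →
       ∃[ y ] Move α p β y × sum (symbols β) ≡ y + sum (after α p ++ before α p)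
move α β p ab (viaLastNonMax (j , a , a≡ , eq) _) =
  _ , lastNonMax j β≡ , trans (cong sum β≡) (sum-middle (before α p) _ _)
  where β≡ = symbols-updated α p a≡ eq
move {M} α β p ab (viaLastSymbol ¬lnm (last , _ , rot) _) = 0 , lastSymbol ¬lnm after≡ x≡M , sum≡
  where
  after≡ : after α p ≡ []
  after≡ = cong (map toℕ) (drop-last α p last)
  x≡M : toℕ (lookup α p) ≡ M
  x≡M = ends-in-max α ab ¬lnm (trans (symbols-lookup α p) (cong (λ e → before α p ++ toℕ (lookup α p) ∷ e) after≡))
  sum≡ : sum (symbols β) ≡ sum (after α p ++ before α p)
  sum≡ with u , v , q , q′ ← ∈[]⇒conjugate _ β rot = begin
    sum (symbols β)                          ≡⟨ cong sum q′ ⟩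
    sum (v ++ u)                             ≡⟨ sum-conjugate v u ⟩
    sum (u ++ v)                             ≡⟨ cong sum q ⟨
    sum (symbols (α [ p ]≔ sucMod (lookup α p)))
                                             ≡⟨ cong sum (symbols-updated α p (sucMod-max (lookup α p) x≡M) refl) ⟩
    sum (before α p ++ 0 ∷ after α p)        ≡⟨ sum-middle (before α p) 0 (after α p) ⟩
    sum (after α p ++ before α p)            ∎
    where open ≡-Reasoning
move α β p ab (viaFirstNonMin ¬lnm ¬ls ((_ , zeros) , a , a≡ , eq) _) =
  toℕ a , firstNonMin st (before-all (_≡ 0) α p zeros) (sym a≡) β≡ , trans (cong sum β≡) (sum-middle (before α p) _ _)
  where
  β≡ = symbols-updated α p refl eq
  st = record { asymBracelet = ab ; ¬lastNonMax = ¬lnm ; ¬lastSymbol = ¬ls }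
move α β p ab (viaSecondLastNonMax ¬lnm ¬ls _ (ℓ , a , a≡ , eq) _) =
  _ , secondLastNonMax st ℓ β≡ , trans (cong sum β≡) (sum-middle (before α p) _ _)
  where
  β≡ = symbols-updated α p a≡ eq
  st = record { asymBracelet = ab ; ¬lastNonMax = ¬lnm ; ¬lastSymbol = ¬ls }

-- Both are rotations of one word, and a rotation class has a single smallest element.
conjugate⇒≡ : (α α′ : Str k n) (p p′ : Fin n) → AsymBracelet α → AsymBracelet α′ →
              after α p ++ before α p ≡ after α′ p′ ++ before α′ p′ →
              toℕ (lookup α p) ≡ toℕ (lookup α′ p′) → α ≡ α′
conjugate⇒≡ α α′ p p′ ab ab′ eq x≡x′
  with u , v , q , q′ ← conjugate (before α p) (after α p) (before α′ p′) (after α′ p′) {toℕ (lookup α p)} eq =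
  symbols-injective α α′ (trans α≡ (trans
    (conjugate-unique u v (subst IsAB α≡ (AsymBracelet⇒IsAB α ab)) (subst IsAB α′≡ (AsymBracelet⇒IsAB α′ ab′)))
    (sym α′≡)))
  where
  α≡ : symbols α ≡ u ++ v
  α≡ = trans (symbols-lookup α p) q
  α′≡ : symbols α′ ≡ v ++ u
  α′≡ = trans (symbols-lookup α′ p′) (trans (cong (λ e → before α′ p′ ++ e ∷ after α′ p′) (sym x≡x′)) q′)

-- Lowering a symbol of β at a position later than its first nonzero symbol
-- is beaten by the rotation which lowers the first nonzero symbol instead.
same-position : ∀ w r w′ r′ → IsAB (w ++ x ∷ r) → All (_≡ 0) w′ → r ++ w ≡ r′ ++ w′ →
                w ++ suc x ∷ r ≡ w′ ++ suc x ∷ r′ → w ≡ w′ × r ≡ r′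
same-position {x} w r w′ r′ ab zeros cyc eq with ++-split w w′ eq
... | inj₁ ([] , refl , eq₁) = sym (++-identityʳ w) , ∷-injectiveʳ eq₁
... | inj₂ ([] , refl , eq₁) = ++-identityʳ w′ , sym (∷-injectiveʳ eq₁)
... | inj₁ (_ ∷ e , refl , eq₁) with refl , _ ← ∷-injective eq₁ with () ∷ _ ← ++⁻ʳ w zeros
... | inj₂ (_ ∷ e , refl , eq₁) with refl , _ ← ∷-injective eq₁
  with u , v , q , q′ ← conjugate w r w′ r′ {x} cyc =
  ⊥-elim (1+n≰n (≤ₗ-head (++-cancelˡ-≤ₗ w′
    (subst₂ _≤ₗ_ (++-assoc w′ (suc x ∷ e) (x ∷ r)) (sym q′) (proj₁ (ab u v q))))))

after-blocks : (α : Str (suc M) n) (ℓ : Fin n) → IsSecondLastNonMax α ℓ →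
               ∃₂ λ c d → ∃[ z ] z < M × after α ℓ ≡ blocks M c z d
after-blocks {M} α ℓ (_ , j , ℓ<j , (j≢ , max) , max′) = go α ℓ j ℓ<j j≢ max max′
  where
  go : ∀ {n} (α : Str (suc M) n) ℓ j → ℓ Fin.< j → ¬ IsMax (lookup α j) →
       (∀ m → j Fin.< m → IsMax (lookup α m)) →
       (∀ m → ℓ Fin.< m → m Fin.< j → IsMax (lookup α m)) →
       ∃₂ λ c d → ∃[ z ] z < M × after α ℓ ≡ blocks M c z d
  go (a ∷ α) zero    (suc j) _         j≢ max max′ = _ , _ , _ , ≤∧≢⇒< (toℕ≤pred[n] (lookup α j)) j≢ ,
    trans (symbols-lookup α j) (cong₂ (λ e f → e ++ toℕ (lookup α j) ∷ f)
      (all≡⇒replicate (before-all (_≡ M) α j (λ m m<j → max′ (suc m) z<s (s<s m<j))))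
      (all≡⇒replicate (after-all (_≡ M) α j (λ m j<m → max (suc m) (s<s j<m)))))
  go (a ∷ α) (suc ℓ) (suc j) (s≤s ℓ<j) j≢ max max′ =
    go α ℓ j ℓ<j j≢ (λ m j<m → max (suc m) (s<s j<m)) (λ m ℓ<m m<j → max′ (suc m) (s<s ℓ<m) (s<s m<j))

-- Mixed cases, with `α′` treated by `FirstNonMin`

module _ (2≤M : 2 ≤ M) (α α′ : Str (suc M) n) (p p′ : Fin n) (ab : AsymBracelet α)
         (cyc : after α p ++ before α p ≡ after α′ p′ ++ before α′ p′)
         (st′ : Stuck α′) (zeros : All (_≡ 0) (before α′ p′)) where

  private
    a  = toℕ (lookup α p)
    i  = length (before α′ p′)

    α′≡ : toℕ (lookup α′ p′) ≡ suc y → symbols α′ ≡ replicate i 0 ++ suc y ∷ after α′ p′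
    α′≡ a′≡ = trans (symbols-lookup α′ p′) (cong₂ (λ e f → e ++ f ∷ after α′ p′) (all≡⇒replicate zeros) a′≡)

  -- If `p′` is the first position, `α′` starts with a nonzero symbol. Otherwise `s α′ p′` ends in
  -- 0, hence so does `s α p`, and `α` ends in `0M`, where 0 can be raised because `1 < M`.
  lastSymbol-firstNonMin : toℕ (lookup α′ p′) ≡ suc y →
                           ¬ YieldsAsymBracelet LastNonMax α → after α p ≡ [] → a ≡ M → ⊥
  lastSymbol-firstNonMin {y} a′≡ ¬lnm r≡[] a≡M = go i (all≡⇒replicate zeros) (α′≡ a′≡)
    where
    r′ = after α′ p′
    go : ∀ i → before α′ p′ ≡ replicate i 0 → symbols α′ ≡ replicate i 0 ++ suc y ∷ r′ → ⊥
    go zero    _   eq = stuck-starts-with-0 α′ st′ eq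
    go (suc i) w′≡ _  = ¬lnm (raise-yields {w = r′ ++ replicate i 0} {t = 1} α ab (begin
      symbols α                                 ≡⟨ symbols-lookup α p ⟩
      before α p ++ a ∷ after α p               ≡⟨ cong₂ (λ e f → before α p ++ e ∷ f) a≡M r≡[] ⟩
      before α p ++ [ M ]                       ≡⟨ cong (λ e → (e ++ before α p) ++ [ M ]) r≡[] ⟨
      (after α p ++ before α p) ++ [ M ]        ≡⟨ cong (_++ [ M ]) cyc ⟩
      (r′ ++ before α′ p′) ++ [ M ]             ≡⟨ cong (λ e → (r′ ++ e) ++ [ M ]) (trans w′≡ (sym (replicate-∷ʳ i))) ⟩
      (r′ ++ replicate i 0 ++ [ 0 ]) ++ [ M ]   ≡⟨ cong (_++ [ M ]) (++-assoc r′ (replicate i 0) [ 0 ]) ⟨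
      ((r′ ++ replicate i 0) ++ [ 0 ]) ++ [ M ] ≡⟨ ++-assoc (r′ ++ replicate i 0) [ 0 ] [ M ] ⟩
      (r′ ++ replicate i 0) ++ 0 ∷ M ∷ []       ∎) (<⇒≤ 2≤M) (inj₂ 2≤M))
      where open ≡-Reasoning

  module _ (a′≡ : toℕ (lookup α′ p′) ≡ suc (suc a))
           (β≡ : before α p ++ suc a ∷ after α p ≡ before α′ p′ ++ suc a ∷ after α′ p′) where

    private
      -- Both changes happen at the same index, so `α′` is `α` with that symbol increased by 2.
      positions : before α p ≡ before α′ p′ × after α p ≡ after α′ p′
      positions = same-position (before α p) (after α p) (before α′ p′) (after α′ p′)
        (subst IsAB (symbols-lookup α p) (AsymBracelet⇒IsAB α ab)) zeros cyc β≡

      α′-after : after α p ≡ r → symbols α′ ≡ replicate i 0 ++ suc (suc a) ∷ r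
      α′-after r≡ = trans (α′≡ a′≡)
        (cong (λ e → replicate i 0 ++ suc (suc a) ∷ e) (trans (sym (proj₂ positions)) r≡))

    lastNonMax-firstNonMin : ¬ IsRoot α′ → IsLastNonMax α p → ⊥
    lastNonMax-firstNonMin ¬root′ (_ , max) = stuck-sorted {m = i} {c = length (after α p)} α′ st′ ¬root′
      (α′-after (all≡⇒replicate (after-all (_≡ M) α p max)))

    secondLastNonMax-firstNonMin : ¬ IsRoot α → Stuck α → IsSecondLastNonMax α p → ⊥
    secondLastNonMax-firstNonMin ¬root st sl with c , d , z , z<M , r≡ ← after-blocks α p sl =
      go i (trans (symbols-lookup α p)
             (cong₂ (λ e f → e ++ a ∷ f) (trans (proj₁ positions) (all≡⇒replicate zeros)) r≡))
        (α′-after r≡)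
      where
      go : ∀ i → symbols α ≡ replicate i 0 ++ a ∷ blocks M c z d →
           symbols α′ ≡ replicate i 0 ++ suc (suc a) ∷ blocks M c z d → ⊥
      go zero    _  eq′ = stuck-starts-with-0 α′ st′ eq′
      go (suc i) eq eq′ = stuck-blocks α α′ 2≤M st st′ ¬root z<M i c d a eq eq′

-- Two raises, two lowerings or two wraps writing the same symbol start from the same symbol, so
-- `conjugate⇒≡` applies. A raise never writes 0, which separates it from a wrap. What remains is
-- `FirstNonMin` against another operation.
chain : 2 ≤ M → (α α′ β : Str (suc M) n) (p p′ : Fin n) → NonRoot α → NonRoot α′ → α ≢ α′ →
        after α p ++ before α p ≡ after α′ p′ ++ before α′ p′ →
        Move α p β y → Move α′ p′ β z → y ≡ z → ⊥
chain 2≤M α α′ β p p′ (ab , ¬root) (ab′ , ¬root′) α≢α′ cyc = go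
  where
  same : toℕ (lookup α p) ≡ toℕ (lookup α′ p′) → ⊥
  same eq = α≢α′ (conjugate⇒≡ α α′ p p′ ab ab′ cyc eq)
  go : Move α p β y → Move α′ p′ β z → y ≡ z → ⊥
  go (lastNonMax _ _)           (lastNonMax _ _)           eq = same (suc-injective eq)
  go (lastNonMax _ _)           (secondLastNonMax _ _ _)   eq = same (suc-injective eq)
  go (secondLastNonMax _ _ _)   (lastNonMax _ _)           eq = same (suc-injective eq)
  go (secondLastNonMax _ _ _)   (secondLastNonMax _ _ _)   eq = same (suc-injective eq)
  go (lastSymbol _ _ eq)        (lastSymbol _ _ eq′)       _  = same (trans eq (sym eq′))
  go (firstNonMin _ _ eq _)     (firstNonMin _ _ eq′ _)    e  = same (trans eq (trans (cong suc e) (sym eq′)))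
  go (lastNonMax _ _)           (lastSymbol _ _ _)         ()
  go (lastSymbol _ _ _)         (lastNonMax _ _)           ()
  go (secondLastNonMax _ _ _)   (lastSymbol _ _ _)         ()
  go (lastSymbol _ _ _)         (secondLastNonMax _ _ _)   ()
  go (lastNonMax j b)           (firstNonMin st′ o x′≡ b′) refl =
    lastNonMax-firstNonMin 2≤M α α′ p p′ ab cyc st′ o x′≡ (trans (sym b) b′) ¬root′ j
  go (firstNonMin st o x≡ b)    (lastNonMax j b′)          refl =
    lastNonMax-firstNonMin 2≤M α′ α p′ p ab′ (sym cyc) st o x≡ (trans (sym b′) b) ¬root j
  go (secondLastNonMax st ℓ b)  (firstNonMin st′ o x′≡ b′) refl =
    secondLastNonMax-firstNonMin 2≤M α α′ p p′ ab cyc st′ o x′≡ (trans (sym b) b′) ¬root st ℓ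
  go (firstNonMin st o x≡ b)    (secondLastNonMax st′ ℓ b′) refl =
    secondLastNonMax-firstNonMin 2≤M α′ α p′ p ab′ (sym cyc) st o x≡ (trans (sym b′) b) ¬root′ st′ ℓ
  go (lastSymbol ¬lnm r≡ x≡M)   (firstNonMin st′ o x′≡ _)  refl =
    lastSymbol-firstNonMin 2≤M α α′ p p′ ab cyc st′ o x′≡ ¬lnm r≡ x≡M
  go (firstNonMin st o x≡ _)    (lastSymbol ¬lnm r≡ x≡M)   refl =
    lastSymbol-firstNonMin 2≤M α′ α p′ p ab′ (sym cyc) st o x≡ ¬lnm r≡ x≡M

mainTheorem10 : (n k : ℕ) → 3 ≤ n → 3 ≤ k →
    ((α β : Str k n) (p : Fin n) →
    NonRoot α → Par α p β → Joined α p β)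
    ×
    ((α α′ β β′ : Str k n) (p p′ : Fin n) →
    NonRoot α → NonRoot α′ → α ≢ α′ →
    Par α p β → Par α′ p′ β′ → β ≡ β′ →
    s α p ≢ s α′ p′)
mainTheorem10 n (suc M) _ (s≤s 2≤M) = (λ α β p _ → joined (s≤s (<⇒≤ 2≤M)) α β p) , distinct
  where
  distinct : (α α′ β β′ : Str (suc M) n) (p p′ : Fin n) → NonRoot α → NonRoot α′ → α ≢ α′ →
             Par α p β → Par α′ p′ β′ → β ≡ β′ → s α p ≢ s α′ p′
  distinct α α′ β β′ p p′ nr nr′ α≢α′ par par′ refl s≡s′
    with y , mv , sum≡ ← move α β p (proj₁ nr) par | y′ , mv′ , sum≡′ ← move α′ β p′ (proj₁ nr′) par′ =
    chain 2≤M α α′ β p p′ nr nr′ α≢α′ cyc mv mv′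
      -- Both sums equal that of `β`, and the remainders agree, so the written symbols do.
      (+-cancelʳ-≡ (sum (after α p ++ before α p)) y y′
        (trans (sym sum≡) (trans sum≡′ (cong (λ e → y′ + sum e) (sym cyc)))))
    where
    cyc : after α p ++ before α p ≡ after α′ p′ ++ before α′ p′
    cyc = trans (sym (symbols-s α p)) (trans (cong (map toℕ) s≡s′) (symbols-s α′ p′))
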